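{- For any positive integer $k$ there exist a finite abelian group $G$ and a generating set $B\subseteq G$ such that the Cayley graph $\mathrm{Cay}(G,B)$ has undirected diameter at most $2$ and directed diameter at least $k$.
   Context: For a finite group $G$ (written additively when abelian) and a generating set $B\subseteq G$, the Cayley graph $\mathrm{Cay}(G,B)$ is the directed graph with vertex set $G$ in which there is a directed edge from $x$ to $y$ if and only if $y=x+g$ for some $g\in B$. The directed diameter of a directed graph is the maximum over ordered pairs of vertices of the length of a shortest path respecting edge orientations (it is finite for such Cayley graphs). The undirected diameter is the maximum distance between two vertices when edge orientations are ignored. -}

module Defs where

open import Algebra.Bundles using (Group)
open import Data.Fin.Base using (Fin)
open import Data.Nat.Base using (ℕ; zero; suc; _≤_)
open import Data.Product.Base using (_×_; _,_; proj₁; proj₂; ∃-syntax)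
open import Function.Bundles using (Inverse)
open import Level using (0ℓ)
open import Relation.Binary.Bundles using (Setoid)
open import Relation.Binary.Construct.Closure.Symmetric using (SymClosure; fwd; bwd)
open import Relation.Binary.Core using (Rel)
open import Relation.Binary.Definitions using (_Respects_; _Respects₂_)
import Relation.Binary.PropositionalEquality as ≡
open import Relation.Unary using (Pred; Decidable)

Finite : Setoid 0ℓ 0ℓ → Set
Finite S = ∃[ n ] Inverse S (≡.setoid (Fin n))

-- Subsets in the classical sense: invariant under the setoid equality, and
-- with decidable membership, which is automatic classically.
record Subset (S : Setoid 0ℓ 0ℓ) : Set₁ where
  open Setoid S
  field
    member      : Pred Carrier 0ℓ
    member-resp : member Respects _≈_
    member?     : Decidable member

-- Vertices are identified up to _≈_. Loops are allowed (they occur in a Cayley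
-- graph when the identity lies in the connection set).
record Digraph : Set₁ where
  field
    vertices : Setoid 0ℓ 0ℓ
  open Setoid vertices using (_≈_) renaming (Carrier to Vertex) public
  field
    Edge      : Rel Vertex 0ℓ
    Edge-resp : Edge Respects₂ _≈_

underlying : Digraph → Digraph
underlying Γ = record
  { vertices  = vertices
  ; Edge      = SymClosure Edge
  ; Edge-resp = right , left
  }
  where
  open Digraph Γ
  right : ∀ {x} → SymClosure Edge x Respects _≈_
  right y≈y′ (fwd e) = fwd (Edge-resp .proj₁ y≈y′ e)
  right y≈y′ (bwd e) = bwd (Edge-resp .proj₂ y≈y′ e)
  left : ∀ {y} → (λ x → SymClosure Edge x y) Respects _≈_
  left x≈x′ (fwd e) = fwd (Edge-resp .proj₂ x≈x′ e)
  left x≈x′ (bwd e) = bwd (Edge-resp .proj₁ x≈x′ e)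

module _ (Γ : Digraph) where
  open Digraph Γ

  -- A walk of minimal length is a path, so allowing repeated vertices does not
  -- affect distances.
  data Walk : Vertex → Vertex → ℕ → Set where
    stop : ∀ {x y} → x ≈ y → Walk x y zero
    step : ∀ {x y z n} → Edge x y → Walk y z n → Walk x z (suc n)

  IsDistance : Vertex → Vertex → ℕ → Set
  IsDistance x y d = Walk x y d × (∀ {n} → Walk x y n → d ≤ n)

  -- D is the maximum of the distances over all ordered pairs of vertices; in
  -- particular all these distances are finite.
  IsDiameter : ℕ → Set
  IsDiameter D = (∀ x y → ∃[ d ] (IsDistance x y d × d ≤ D))
               × (∃[ x ] ∃[ y ] IsDistance x y D)

IsDirectedDiameter : Digraph → ℕ → Set
IsDirectedDiameter = IsDiameter

IsUndirectedDiameter : Digraph → ℕ → Set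
IsUndirectedDiameter Γ = IsDiameter (underlying Γ)

module _ (G : Group 0ℓ 0ℓ) (B : Subset (Group.setoid G)) where
  open Group G
  open Subset B

  -- Membership in the subgroup generated by B.
  data Span : Carrier → Set where
    incl  : ∀ {x} → member x → Span x
    unit  : Span ε
    mul   : ∀ {x y} → Span x → Span y → Span (x ∙ y)
    inv   : ∀ {x} → Span x → Span (x ⁻¹)
    equal : ∀ {x y} → x ≈ y → Span x → Span y

  Generates : Set
  Generates = ∀ x → Span x

  Cay : Digraph
  Cay = record
    { vertices  = setoid
    ; Edge      = λ x y → ∃[ g ] (member g × y ≈ x ∙ g)
    ; Edge-resp = (λ y≈y′ (g , g∈B , y≈xg) → g , g∈B , trans (sym y≈y′) y≈xg)
                , (λ x≈x′ (g , g∈B , y≈xg) → g , g∈B , trans y≈xg (∙-congʳ x≈x′))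
    }

{-# OPTIONS --safe #-}
module Submission where

-- With q = k! + 1, take B = { f x + e x : x ∈ G, e ∈ {0,1} } in G = (ℤ/q)ⁿ, so
-- that B − B = G and the undirected diameter is at most 2. The map f is built in
-- levels so that no sum of at most k elements of B that involves at most l
-- distinct x equals (1,…,1) at level l. Level l + 1 adds one coordinate for each
-- map τ from the level-l group G_l to ℤ/q, where f multiplies x_τ by
-- τ(x restricted to G_l). Consider a sum with l + 1 distinct x. If two of them
-- agree on G_l, level l applies. Otherwise τ can be prescribed on each of them
-- independently: if x occurs n ≤ k times in the sum, b of them with e = 1, then
-- n is invertible mod q, so n τ(x) + b = 0 has a solution, and with these values
-- the coordinate τ of the sum is 0.

open import Defs
open import Algebra.Bundles using (AbelianGroup; Group)
import Algebra.Construct.Pointwise as Pointwise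
import Algebra.Properties.CommutativeMonoid.Sum as MonoidSum
import Algebra.Properties.Group as GroupProperties
import Algebra.Properties.Semiring.Sum as SemiringSum
open import Data.Bool.Base using (if_then_else_)
open import Data.Fin.Base
  using (Fin; zero; suc; toℕ; fromℕ<; combine; funToFin; finToFun; punchIn; punchOut; _↑ˡ_; _↑ʳ_)
open import Data.Fin.Properties
  using (_≟_; any?; toℕ<n; toℕ-injective; toℕ-fromℕ<; funToFin-finToFin; finToFun-funToFin; punchIn-punchOut)
open import Data.List.Base using (allFin; cartesianProduct)
import Data.List.Extrema as Extrema
open import Data.List.Membership.Propositional.Properties using (∈-allFin; ∈-cartesianProduct⁺)
open import Data.List.Relation.Unary.All using (lookup)
open import Data.Nat.Base using (ℕ; zero; suc; _+_; _*_; _^_; _%_; _!; _≤_; _<_; z≤n; s≤s; s≤s⁻¹)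
open import Data.Nat.Divisibility using (divides; m≤n⇒m!∣n!; m∣m*n; ∣-trans)
open import Data.Nat.DivMod
  using (%-distribˡ-+; %-distribˡ-*; m%n<n; m%n%n≡m%n; [m+kn]%n≡m%n; m<n⇒m%n≡m)
open import Data.Nat.Properties
  using (+-*-semiring; +-assoc; +-comm; +-identityʳ; *-comm; *-mono-≤; *-identityʳ;
         *-identityˡ; +-mono-≤; ≤-refl; ≤-trans; ≤-reflexive; ≤-totalOrder; n≤0⇒n≡0; 1≤n!;
         _≤?_; ≰⇒>; <⇒≤)
open import Data.Nat.Tactic.RingSolver using (solve-∀)
open import Data.Product.Base using (Σ; _×_; _,_; proj₁; proj₂; ∃-syntax; ∃₂)
open import Data.Sum.Base using (_⊎_; inj₁; inj₂)
open import Data.Vec.Functional using (Vector; _∷_; _++_)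
open import Data.Vec.Functional.Properties using (lookup-++ˡ; lookup-++ʳ)
open import Data.Vec.Functional.Relation.Binary.Pointwise.Properties using (++⁺)
open import Function.Base using (_∘_; const; id)
open import Function.Bundles using (Inverse)
open import Level using (0ℓ)
open import Relation.Binary.Bundles using (Setoid)
open import Relation.Binary.Construct.Closure.Symmetric using (SymClosure; fwd; bwd)
open import Relation.Binary.PropositionalEquality
  using (_≡_; _≢_; _≗_; refl; sym; trans; cong; cong₂; module ≡-Reasoning)
import Relation.Binary.Reasoning.Setoid as SetoidReasoning
open import Relation.Nullary using (Dec; yes; no; does; ¬_; contradiction)
open import Relation.Nullary.Decidable using (map′; _×-dec_; _⊎-dec_; ¬?)
open import Relation.Unary using (Decidable)

-- Minimal witnesses and decidability over finite setoids.

least : ∀ {P : ℕ → Set} → Decidable P → ∀ n → P n → ∃[ m ] (P m × (∀ {j} → P j → m ≤ j))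
least P? n pn with P? 0
least P? n       pn | yes p0 = 0 , p0 , λ _ → z≤n
least P? zero    pn | no ¬p0 = contradiction pn ¬p0
least {P} P? (suc n) pn | no ¬p0 with least (P? ∘ suc) n pn
... | m , pm , minimal = suc m , pm , minimal′
  where
  minimal′ : ∀ {j} → P j → suc m ≤ j
  minimal′ {zero}  p = contradiction p ¬p0
  minimal′ {suc j} p = s≤s (minimal p)

module _ {S : Setoid 0ℓ 0ℓ} (finite : Finite S) where
  open Setoid S renaming (refl to ≈-refl; sym to ≈-sym; trans to ≈-trans)
  open Inverse (proj₂ finite)

  decode∘encode : ∀ x → from (to x) ≈ x
  decode∘encode x = inverseʳ refl

  finite⇒dec : ∀ x y → Dec (x ≈ y)
  finite⇒dec x y = map′
    (λ e → ≈-trans (≈-sym (decode∘encode x)) (≈-trans (from-cong e) (decode∘encode y)))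
    to-cong
    (to x ≟ to y)

  finite⇒∃? : ∀ {P : Carrier → Set} → (∀ {x y} → x ≈ y → P x → P y) → Decidable P → Dec (∃[ x ] P x)
  finite⇒∃? P-resp P? = map′
    (λ (i , p) → from i , p)
    (λ (x , p) → to x , P-resp (≈-sym (decode∘encode x)) p)
    (any? (P? ∘ from))

-- Walks, distances and the existence of diameters.

module _ (Γ : Digraph) where
  open Digraph Γ
  open Setoid vertices using () renaming (refl to ≈-refl; sym to ≈-sym; trans to ≈-trans)

  Walk-resp : ∀ {x x′ y y′ n} → x ≈ x′ → y ≈ y′ → Walk Γ x y n → Walk Γ x′ y′ n
  Walk-resp x≈x′ y≈y′ (stop x≈y)  = stop (≈-trans (≈-sym x≈x′) (≈-trans x≈y y≈y′))
  Walk-resp x≈x′ y≈y′ (step xz w) = step (proj₂ Edge-resp x≈x′ xz) (Walk-resp ≈-refl y≈y′ w)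

  IsDistance-resp : ∀ {x x′ y y′ d} → x ≈ x′ → y ≈ y′ → IsDistance Γ x y d → IsDistance Γ x′ y′ d
  IsDistance-resp x≈x′ y≈y′ (w , minimal) =
    Walk-resp x≈x′ y≈y′ w , minimal ∘ Walk-resp (≈-sym x≈x′) (≈-sym y≈y′)

  diameter-≤ : ∀ {D b} → IsDiameter Γ D → (∀ x y → Walk Γ x y b) → D ≤ b
  diameter-≤ (_ , x , y , _ , minimal) walk = minimal (walk x y)

  ≤-diameter : ∀ {D b x y} → IsDiameter Γ D → (∀ {n} → Walk Γ x y n → b ≤ n) → b ≤ D
  ≤-diameter {x = x} {y} (bounded , _) b≤ with bounded x y
  ... | _ , (w , _) , d≤D = ≤-trans (b≤ w) d≤D

  module _ (finite : Finite vertices) (edge? : ∀ x y → Dec (Edge x y)) where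
    open Inverse (proj₂ finite) using (to; from)

    -- Induction on the length: the second vertex of a walk can be found by finite search, because
    -- edges and walks respect `_≈_`.
    walk? : ∀ x y n → Dec (Walk Γ x y n)
    walk? x y zero    = map′ stop (λ where (stop x≈y) → x≈y) (finite⇒dec finite x y)
    walk? x y (suc n) = map′ (λ (_ , xz , w) → step xz w) (λ where (step xz w) → _ , xz , w)
      (finite⇒∃? finite
        (λ z≈z′ (xz , w) → proj₁ Edge-resp z≈z′ xz , Walk-resp z≈z′ ≈-refl w)
        (λ z → edge? x z ×-dec walk? z y n))

    module _ (walk : ∀ x y → ∃[ n ] Walk Γ x y n) (origin : Vertex) where

      distance : ∀ x y → ∃[ d ] IsDistance Γ x y d
      distance x y = let n , w = walk x y in least (walk? x y) n w

      -- The maximum runs over decoded vertices only. This suffices because every vertex is equal to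
      -- a decoded one and distances respect `_≈_`.
      diameter : ∃[ D ] IsDiameter Γ D
      diameter = dist farthest , bounded , _ , _ , isDist farthest
        where
        open Extrema ≤-totalOrder
        Pair = Fin (proj₁ finite) × Fin (proj₁ finite)

        dist : Pair → ℕ
        dist (i , j) = proj₁ (distance (from i) (from j))

        isDist : ∀ ((i , j) : Pair) → IsDistance Γ (from i) (from j) (dist (i , j))
        isDist (i , j) = proj₂ (distance (from i) (from j))

        farthest : Pair
        -- A maximum needs a pair to start from; `origin` supplies it.
        farthest = argmax dist (to origin , to origin) (cartesianProduct (allFin _) (allFin _))

        bounded : ∀ x y → ∃[ d ] (IsDistance Γ x y d × d ≤ dist farthest)
        bounded x y = _
          , IsDistance-resp (decode∘encode finite x) (decode∘encode finite y) (isDist (to x , to y))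
          , lookup (f[xs]≤f[argmax] {f = dist} _ _) (∈-cartesianProduct⁺ (∈-allFin (to x)) (∈-allFin (to y)))

-- Decidable adjacency in Cayley graphs.

module _ (G : Group 0ℓ 0ℓ) (B : Subset (Group.setoid G)) where
  open Group G renaming (refl to ≈-refl; sym to ≈-sym; trans to ≈-trans)
  open Subset B
  open GroupProperties G using (\\-leftDividesˡ; \\-leftDividesʳ)

  -- Cancellation makes `x ⁻¹ ∙ y` the only candidate for the generator, so one membership test is
  -- enough.
  Cay-edge? : ∀ x y → Dec (Digraph.Edge (Cay G B) x y)
  Cay-edge? x y = map′
    (λ g∈B → x ⁻¹ ∙ y , g∈B , ≈-sym (\\-leftDividesˡ x y))
    (λ (g , g∈B , y≈xg) → member-resp (≈-trans (≈-sym (\\-leftDividesʳ x g)) (∙-congˡ (≈-sym y≈xg))) g∈B)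
    (member? (x ⁻¹ ∙ y))

SymClosure? : ∀ {A : Set} {R : A → A → Set} → (∀ x y → Dec (R x y)) → ∀ x y → Dec (SymClosure R x y)
SymClosure? R? x y = map′
  (λ where (inj₁ xy) → fwd xy
           (inj₂ yx) → bwd yx)
  (λ where (fwd xy) → inj₁ xy
           (bwd yx) → inj₂ yx)
  (R? x y ⊎-dec R? y x)

-- Codes of finite maps and sums over fibres.

funToFin-cong : ∀ {m n} {f g : Fin m → Fin n} → f ≗ g → funToFin f ≡ funToFin g
funToFin-cong {zero}  f≗g = refl
funToFin-cong {suc m} f≗g = cong₂ combine (f≗g zero) (funToFin-cong (f≗g ∘ suc))

open SemiringSum +-*-semiring
  using (sum; sum-syntax; sum-cong-≗; sum-replicate-zero; ∑-comm; ∑-distrib-+; *-distribʳ-sum)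

δ : ∀ {m} → Fin m → Fin m → ℕ
δ i j = if does (i ≟ j) then 1 else 0

δ≤1 : ∀ {m} (i j : Fin m) → δ i j ≤ 1
δ≤1 i j with i ≟ j
... | yes _ = ≤-refl
... | no  _ = z≤n

∑-δ : ∀ {m} (h : Fin m → ℕ) j → ∑[ i < m ] (δ i j * h i) ≡ h j
∑-δ {suc m} h zero    = trans (cong₂ _+_ (*-identityˡ (h zero)) (sum-replicate-zero m)) (+-identityʳ _)
∑-δ {suc m} h (suc j) = ∑-δ (h ∘ suc) j

∑-mono-≤ : ∀ {n} {f g : Fin n → ℕ} → (∀ s → f s ≤ g s) → sum f ≤ sum g
∑-mono-≤ {zero}  f≤g = z≤n
∑-mono-≤ {suc n} f≤g = +-mono-≤ (f≤g zero) (∑-mono-≤ (f≤g ∘ suc))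

∑-≤-length : ∀ {n} {f : Fin n → ℕ} → (∀ s → f s ≤ 1) → sum f ≤ n
∑-≤-length {zero}  f≤1 = z≤n
∑-≤-length {suc n} f≤1 = +-mono-≤ (f≤1 zero) (∑-≤-length (f≤1 ∘ suc))

module _ {m n} (c : Fin n → Fin m) (ε : Fin n → ℕ) where

  -- In a sum of elements of the connection set, `c s` is the index of the point x used by summand
  -- `s`, and `ε s` is its e. Then `count i` and `weight i` are the numbers n and b belonging to
  -- point `i`.
  count : Fin m → ℕ
  count i = ∑[ s < n ] δ i (c s)

  weight : Fin m → ℕ
  weight i = ∑[ s < n ] (δ i (c s) * ε s)

  weight≤count : (∀ s → ε s ≤ 1) → ∀ i → weight i ≤ count i
  weight≤count ε≤1 i =
    ∑-mono-≤ λ s → ≤-trans (*-mono-≤ (≤-refl {δ i (c s)}) (ε≤1 s)) (≤-reflexive (*-identityʳ _))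

  -- Inserting `δ i (c s)` and interchanging the two sums gathers the summands with the same point.
  -- The coefficient of `y i` is the quantity that τ will make 0 modulo q.
  ∑-by-fibres : ∀ (r y : Fin m → ℕ) →
    ∑[ s < n ] (r (c s) * y (c s) + ε s * y (c s)) ≡ ∑[ i < m ] ((count i * r i + weight i) * y i)
  ∑-by-fibres r y = begin
    ∑[ s < n ] (r (c s) * y (c s) + ε s * y (c s))
      ≡⟨ sum-cong-≗ (λ s → sym (∑-δ (λ i → r i * y i + ε s * y i) (c s))) ⟩
    ∑[ s < n ] ∑[ i < m ] (δ i (c s) * (r i * y i + ε s * y i))
      ≡⟨ ∑-comm {n} {m} _ ⟩
    ∑[ i < m ] ∑[ s < n ] (δ i (c s) * (r i * y i + ε s * y i))
      ≡⟨ sum-cong-≗ fibre ⟩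
    ∑[ i < m ] ((count i * r i + weight i) * y i) ∎
    where
    open ≡-Reasoning

    factor : ∀ d r ε y → d * (r * y + ε * y) ≡ (d * r + d * ε) * y
    factor = solve-∀

    fibre : ∀ i → ∑[ s < n ] (δ i (c s) * (r i * y i + ε s * y i)) ≡ (count i * r i + weight i) * y i
    fibre i = begin
      ∑[ s < n ] (δ i (c s) * (r i * y i + ε s * y i))
        ≡⟨ sum-cong-≗ (λ s → factor (δ i (c s)) (r i) (ε s) (y i)) ⟩
      ∑[ s < n ] ((δ i (c s) * r i + δ i (c s) * ε s) * y i)
        ≡⟨ *-distribʳ-sum (y i) (λ s → δ i (c s) * r i + δ i (c s) * ε s) ⟨
      (∑[ s < n ] (δ i (c s) * r i + δ i (c s) * ε s)) * y i
        ≡⟨ cong (_* y i) (∑-distrib-+ (λ s → δ i (c s) * r i) _) ⟩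
      (∑[ s < n ] (δ i (c s) * r i) + weight i) * y i
        ≡⟨ cong (λ u → (u + weight i) * y i) (*-distribʳ-sum (r i) (λ s → δ i (c s))) ⟨
      (count i * r i + weight i) * y i ∎

-- Extending and merging finite maps.

extend-along : ∀ {m n} {A : Set} (e : Fin m → Fin n) → (∀ {i j} → e i ≡ e j → i ≡ j) →
               (r : Fin m → A) → A → ∃[ r′ ] (∀ i → r′ (e i) ≡ r i)
extend-along {m} {n} {A} e e-injective r default = r′ , r′-extends
  where
  r′ : Fin n → A
  r′ j with any? (λ i → e i ≟ j)
  ... | yes (i , _) = r i
  ... | no _        = default

  r′-extends : ∀ i → r′ (e i) ≡ r i
  r′-extends i with any? (λ i′ → e i′ ≟ e i)
  ... | yes (_ , p) = cong r (e-injective p)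
  ... | no ∄i       = contradiction (i , refl) ∄i

injective-or-collides : ∀ {m n} (e : Fin m → Fin n) →
  (∀ {i j} → e i ≡ e j → i ≡ j) ⊎ (∃₂ λ i j → i ≢ j × e i ≡ e j)
injective-or-collides e with any? (λ i → any? (λ j → ¬? (i ≟ j) ×-dec e i ≟ e j))
... | yes collision = inj₂ collision
... | no ∄collision = inj₁ injective
  where
  injective : ∀ {i j} → e i ≡ e j → i ≡ j
  injective {i} {j} p with i ≟ j
  ... | yes i≡j = i≡j
  ... | no  i≢j = contradiction (i , j , i≢j , p) ∄collision

-- Index `i` is discarded in favour of `j`: composing with `ρ` relabels a sum by one point fewer,
-- and only `i` changes its label.
merge : ∀ {m} {i j : Fin (suc m)} → i ≢ j →
        Σ (Fin (suc m) → Fin m) λ ρ → (∀ a → punchIn i (ρ a) ≡ a ⊎ (a ≡ i × punchIn i (ρ a) ≡ j))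
merge {m} {i} {j} i≢j = ρ , ρ-spec
  where
  ρ : Fin (suc m) → Fin m
  ρ a with i ≟ a
  ... | yes _   = punchOut i≢j
  ... | no  i≢a = punchOut i≢a

  ρ-spec : ∀ a → punchIn i (ρ a) ≡ a ⊎ (a ≡ i × punchIn i (ρ a) ≡ j)
  ρ-spec a with i ≟ a
  ... | yes i≡a = inj₂ (sym i≡a , punchIn-punchOut i≢j)
  ... | no  i≢a = inj₁ (punchIn-punchOut i≢a)

-- Arithmetic modulo `q`.

module Construction (k : ℕ) where

  -- Every n ≤ k is invertible modulo q, with inverse −k!/n, because k! ≡ −1.
  q : ℕ
  q = suc (k !)

  infix 4 _≈_
  record _≈_ (a b : ℕ) : Set where
    constructor mod-≡
    field
      %-≡ : a % q ≡ b % q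

  ≈-refl : ∀ {a} → a ≈ a
  ≈-refl = mod-≡ refl

  ≈-sym : ∀ {a b} → a ≈ b → b ≈ a
  ≈-sym (mod-≡ p) = mod-≡ (sym p)

  ≈-trans : ∀ {a b c} → a ≈ b → b ≈ c → a ≈ c
  ≈-trans (mod-≡ p) (mod-≡ p′) = mod-≡ (trans p p′)

  ≡⇒≈ : ∀ {a b} → a ≡ b → a ≈ b
  ≡⇒≈ refl = ≈-refl

  +-cong : ∀ {a a′ b b′} → a ≈ a′ → b ≈ b′ → a + b ≈ a′ + b′
  +-cong {a} {a′} {b} {b′} (mod-≡ p) (mod-≡ p′) = mod-≡
    (trans (%-distribˡ-+ a b q) (trans (cong₂ (λ u v → (u + v) % q) p p′) (sym (%-distribˡ-+ a′ b′ q))))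

  *-cong : ∀ {a a′ b b′} → a ≈ a′ → b ≈ b′ → a * b ≈ a′ * b′
  *-cong {a} {a′} {b} {b′} (mod-≡ p) (mod-≡ p′) = mod-≡
    (trans (%-distribˡ-* a b q) (trans (cong₂ (λ u v → (u * v) % q) p p′) (sym (%-distribˡ-* a′ b′ q))))

  +-multiple : ∀ a b → a + b * q ≈ a
  +-multiple a b = mod-≡ ([m+kn]%n≡m%n a b q)

  0≉1 : ¬ (0 ≈ 1)
  0≉1 (mod-≡ 0≡1%q) = contradiction (trans 0≡1%q (m<n⇒m%n≡m (s≤s (1≤n! k)))) λ ()

  neg-inverseʳ : ∀ a → a + k ! * a ≈ 0
  neg-inverseʳ a = ≈-trans (≡⇒≈ (*-comm q a)) (+-multiple 0 a)

  -- Residues are arbitrary naturals up to congruence, so group identities reduce to identities in ℕ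
  -- up to a multiple of `q`.
  ℤ/q : AbelianGroup 0ℓ 0ℓ
  ℤ/q = record
    { Carrier = ℕ
    ; _≈_     = _≈_
    ; _∙_     = _+_
    ; ε       = 0
    ; _⁻¹     = k ! *_
    ; isAbelianGroup = record
      { isGroup = record
        { isMonoid = record
          { isSemigroup = record
            { isMagma = record
              { isEquivalence = record { refl = ≈-refl ; sym = ≈-sym ; trans = ≈-trans }
              ; ∙-cong        = +-cong
              }
            ; assoc = λ a b c → ≡⇒≈ (+-assoc a b c)
            }
          ; identity = (λ _ → ≈-refl) , λ a → ≡⇒≈ (+-identityʳ a)
          }
        ; inverse = (λ a → ≈-trans (≡⇒≈ (+-comm (k ! * a) a)) (neg-inverseʳ a)) , neg-inverseʳ
        ; ⁻¹-cong = *-cong (≈-refl {k !})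
        }
      ; comm = λ a b → ≡⇒≈ (+-comm a b)
      }
    }

  open AbelianGroup ℤ/q using (commutativeMonoid; setoid)
  open MonoidSum commutativeMonoid using () renaming (sum-cong-≋ to ∑-cong)

  residue : ℕ → Fin q
  residue a = fromℕ< (m%n<n a q)

  residue-cong : ∀ {a b} → a ≈ b → residue a ≡ residue b
  residue-cong {a} {b} (mod-≡ p) =
    toℕ-injective (trans (toℕ-fromℕ< _) (trans p (sym (toℕ-fromℕ< (m%n<n b q)))))

  toℕ-residue : ∀ a → toℕ (residue a) ≈ a
  toℕ-residue a = mod-≡ (trans (cong (_% q) (toℕ-fromℕ< (m%n<n a q))) (m%n%n≡m%n a q))

  residue-toℕ : ∀ i → residue (toℕ i) ≡ i
  residue-toℕ i = toℕ-injective (trans (toℕ-fromℕ< _) (m<n⇒m%n≡m (toℕ<n i)))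

  -- For n > 0, n divides n!, which divides k!. Write k! = d n and take r congruent to b d: then n r
  -- + b is congruent to b (k! + 1) = b q. For n = 0 the bound b ≤ n forces b = 0.
  solve-residue : ∀ {n b} → n ≤ k → b ≤ n → Σ (Fin q) λ r → n * toℕ r + b ≈ 0
  solve-residue {zero}      n≤k b≤0 = zero , ≡⇒≈ (n≤0⇒n≡0 b≤0)
  solve-residue {n@(suc n-1)} {b} n≤k b≤n with ∣-trans (m∣m*n (n-1 !)) (m≤n⇒m!∣n! n≤k)
  ... | divides d k!≡dn = residue (b * d) , (begin
    n * toℕ (residue (b * d)) + b  ≈⟨ +-cong (*-cong (≈-refl {n}) (toℕ-residue (b * d))) ≈-refl ⟩
    n * (b * d) + b                ≡⟨ rearrange n b d ⟩
    b * suc (d * n)                ≡⟨ cong (λ u → b * suc u) k!≡dn ⟨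
    b * q                          ≈⟨ +-multiple 0 b ⟩
    0                              ∎)
    where
    open SetoidReasoning setoid
    rearrange : ∀ n b d → n * (b * d) + b ≡ b * suc (d * n)
    rearrange = solve-∀

  -- Powers of ℤ/q and their finiteness.

  infix 4 _≋_
  V : ℕ → AbelianGroup 0ℓ 0ℓ
  V m = Pointwise.abelianGroup (Fin m) ℤ/q

  _≋_ : ∀ {m} → Vector ℕ m → Vector ℕ m → Set
  _≋_ {m} = AbelianGroup._≈_ (V m)

  finite : ∀ m → Finite (AbelianGroup.setoid (V m))
  finite m = q ^ m , record
    { to        = encode
    ; from      = decode
    ; to-cong   = encode-cong
    ; from-cong = λ where refl _ → ≈-refl
    ; inverse   = (λ {i} p → trans (encode-cong p) (encode∘decode i))
                , (λ {x} p j → ≈-trans (≡⇒≈ (cong (λ i → decode i j) p)) (decode∘encode′ x j))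
    }
    where
    encode : Vector ℕ m → Fin (q ^ m)
    encode x = funToFin (residue ∘ x)

    decode : Fin (q ^ m) → Vector ℕ m
    decode i = toℕ ∘ finToFun i

    encode-cong : ∀ {x y : Vector ℕ m} → x ≋ y → encode x ≡ encode y
    encode-cong x≋y = funToFin-cong (residue-cong ∘ x≋y)

    encode∘decode : ∀ i → encode (decode i) ≡ i
    encode∘decode i =
      trans (funToFin-cong {m} (λ j → residue-toℕ (finToFun i j))) (funToFin-finToFin {m} {q} i)

    decode∘encode′ : ∀ x → decode (encode x) ≋ x
    decode∘encode′ x j =
      ≈-trans (≡⇒≈ (cong toℕ (finToFun-funToFin (residue ∘ x) j))) (toℕ-residue (x j))

  -- The tower of groups and the map f.

  -- The coordinates added at each level are indexed by all maps from the
  -- elements of the previous group to ℤ/q.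
  dim : ℕ → ℕ
  dim zero    = 1
  dim (suc l) = dim l + q ^ (q ^ dim l)

  restrict : ∀ l → Vector ℕ (dim (suc l)) → Vector ℕ (dim l)
  restrict l x = x ∘ (_↑ˡ q ^ (q ^ dim l))

  -- Numbering the elements of the level-`l` group lets a map from it to ℤ/q be coded by one element
  -- of a `Fin`.
  colour : ∀ l → Vector ℕ (dim l) → Fin (q ^ dim l)
  colour l = Inverse.to (proj₂ (finite (dim l)))

  colour-cong : ∀ l {x y} → x ≋ y → colour l x ≡ colour l y
  colour-cong l = Inverse.to-cong (proj₂ (finite (dim l)))

  colour-injective : ∀ l {x y} → colour l x ≡ colour l y → x ≋ y
  colour-injective l {x} {y} p = begin
    x                  ≈⟨ decode∘encode (finite (dim l)) x ⟨
    from (colour l x)  ≡⟨ cong from p ⟩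
    from (colour l y)  ≈⟨ decode∘encode (finite (dim l)) y ⟩
    y                  ∎
    where
    open Inverse (proj₂ (finite (dim l))) using (from)
    open SetoidReasoning (AbelianGroup.setoid (V (dim l)))

  multiplier : ∀ l → Fin (q ^ (q ^ dim l)) → Vector ℕ (dim l) → ℕ
  multiplier l τ x = toℕ (finToFun {q} {q ^ dim l} τ (colour l x))

  -- This is the map f. Its old coordinates depend only on `restrict l x`, so sums at level `suc l`
  -- restrict to sums at level `l`.
  shift : ∀ l → Vector ℕ (dim l) → Vector ℕ (dim l)
  shift zero    x = const 0
  shift (suc l) x = shift l (restrict l x) ++ λ τ → multiplier l τ (restrict l x) * x (dim l ↑ʳ τ)

  shift-cong : ∀ l {x y} → x ≋ y → shift l x ≋ shift l y
  shift-cong zero    x≋y = λ _ → ≈-refl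
  shift-cong (suc l) x≋y = ++⁺ _≈_ (shift-cong l (x≋y ∘ (_↑ˡ _)))
    λ τ → *-cong (≡⇒≈ (cong (toℕ ∘ finToFun {q} {q ^ dim l} τ) (colour-cong l (x≋y ∘ (_↑ˡ _))))) (x≋y (dim l ↑ʳ τ))

  term : ∀ l → Vector ℕ (dim l) → Fin 2 → Vector ℕ (dim l)
  term l x ε j = shift l x j + toℕ ε * x j

  term-cong : ∀ l {x y} ε → x ≋ y → term l x ε ≋ term l y ε
  term-cong l ε x≋y j = +-cong (shift-cong l x≋y j) (*-cong (≈-refl {toℕ ε}) (x≋y j))

  term-↑ˡ : ∀ l x ε j → term (suc l) x ε (j ↑ˡ _) ≡ term l (restrict l x) ε j
  term-↑ˡ l x ε j = cong (_+ toℕ ε * x (j ↑ˡ _)) (lookup-++ˡ (shift l (restrict l x)) _ j)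

  term-↑ʳ : ∀ l x ε τ → term (suc l) x ε (dim l ↑ʳ τ)
    ≡ multiplier l τ (restrict l x) * x (dim l ↑ʳ τ) + toℕ ε * x (dim l ↑ʳ τ)
  term-↑ʳ l x ε τ = cong (_+ toℕ ε * x (dim l ↑ʳ τ)) (lookup-++ʳ (shift l (restrict l x)) _ τ)

  -- Sums of few elements avoid (1,...,1).

  toℕ≤1 : ∀ (ε : Fin 2) → toℕ ε ≤ 1
  toℕ≤1 ε = s≤s⁻¹ (toℕ<n ε)

  ∑-term-↑ʳ : ∀ l {m n} (x : Fin m → Vector ℕ (dim (suc l))) (c : Fin n → Fin m) (ε : Fin n → Fin 2) τ →
    ∑[ s < n ] term (suc l) (x (c s)) (ε s) (dim l ↑ʳ τ)
      ≡ ∑[ i < m ] ((count c (toℕ ∘ ε) i * multiplier l τ (restrict l (x i)) + weight c (toℕ ∘ ε) i)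
                    * x i (dim l ↑ʳ τ))
  ∑-term-↑ʳ l x c ε τ = trans
    (sum-cong-≗ (λ s → term-↑ʳ l (x (c s)) (ε s) τ))
    (∑-by-fibres c (toℕ ∘ ε) (λ i → multiplier l τ (restrict l (x i))) (λ i → x i (dim l ↑ʳ τ)))

  -- Distinct colours make the prescribed values a partial function, which extends to the whole
  -- group; `τ` is the code of the extension.
  prescribe-multipliers : ∀ l {m} (y : Fin m → Vector ℕ (dim l)) →
    (∀ {i j} → colour l (y i) ≡ colour l (y j) → i ≡ j) →
    (r : Fin m → Fin q) → ∃[ τ ] (∀ i → multiplier l τ (y i) ≡ toℕ (r i))
  prescribe-multipliers l y colour-inj r with extend-along (λ i → colour l (y i)) colour-inj r zero
  ... | r′ , r′-extends = funToFin r′ , λ i →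
    cong toℕ (trans (finToFun-funToFin r′ (colour l (y i))) (r′-extends i))

  -- Each of the n summands adds at most 1 to the count of `i`, so the count is at most k and
  -- `solve-residue` applies to it.
  cancelling-residue : ∀ {m n} → n ≤ k → (c : Fin n → Fin m) (ε : Fin n → Fin 2) →
    ∀ i → Σ (Fin q) λ r → count c (toℕ ∘ ε) i * toℕ r + weight c (toℕ ∘ ε) i ≈ 0
  cancelling-residue n≤k c ε i =
    solve-residue (≤-trans (∑-≤-length (λ s → δ≤1 i (c s))) n≤k) (weight≤count c (toℕ ∘ ε) (toℕ≤1 ∘ ε) i)

  -- The case of distinct restrictions: `τ` takes the cancelling residues as values, so in
  -- coordinate `τ` the coefficient of every point is 0.
  vanishing-coordinate : ∀ l {m n} → n ≤ k → (x : Fin m → Vector ℕ (dim (suc l))) →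
    (∀ {i j} → colour l (restrict l (x i)) ≡ colour l (restrict l (x j)) → i ≡ j) →
    (c : Fin n → Fin m) (ε : Fin n → Fin 2) →
    ∃[ j ] (∑[ s < n ] term (suc l) (x (c s)) (ε s) j ≈ 0)
  vanishing-coordinate l {m} {n} n≤k x colour-inj c ε
    with prescribe-multipliers l (restrict l ∘ x) colour-inj (proj₁ ∘ cancelling-residue n≤k c ε)
  ... | τ , τ-spec = dim l ↑ʳ τ , ≈-trans (≡⇒≈ (∑-term-↑ʳ l x c ε τ))
    (≈-trans (∑-cong summand≈0) (≡⇒≈ (sum-replicate-zero m)))
    where
    coefficient≈0 : ∀ i → count c (toℕ ∘ ε) i * multiplier l τ (restrict l (x i)) + weight c (toℕ ∘ ε) i ≈ 0
    coefficient≈0 i = ≈-trans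
      (≡⇒≈ (cong (λ u → count c (toℕ ∘ ε) i * u + weight c (toℕ ∘ ε) i) (τ-spec i)))
      (proj₂ (cancelling-residue n≤k c ε i))

    summand≈0 : ∀ i →
      (count c (toℕ ∘ ε) i * multiplier l τ (restrict l (x i)) + weight c (toℕ ∘ ε) i) * x i (dim l ↑ʳ τ) ≈ 0
    summand≈0 i = *-cong (coefficient≈0 i) (≈-refl {x i (dim l ↑ʳ τ)})

  -- Induction on `l`. The points `x i` need not be distinct, since m only bounds their number; two
  -- points with equal restrictions allow m and the level to drop together.
  avoids-1 : ∀ l {m n} → m ≤ l → n ≤ k →
    (x : Fin m → Vector ℕ (dim l)) (c : Fin n → Fin m) (ε : Fin n → Fin 2) →
    ¬ (∀ j → ∑[ s < n ] term l (x (c s)) (ε s) j ≈ 1)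
  -- Without points the sum is empty, and its value 0 differs from 1 in the single coordinate of
  -- level 0.
  avoids-1 zero {zero} {zero}  m≤l n≤k x c ε total≈1 = 0≉1 (total≈1 zero)
  avoids-1 zero {zero} {suc n} m≤l n≤k x c ε total≈1 with () ← c zero
  avoids-1 (suc l) {m} {n} m≤l n≤k x c ε total≈1
    with injective-or-collides (λ i → colour l (restrict l (x i)))
  ... | inj₁ colour-inj with vanishing-coordinate l n≤k x colour-inj c ε
  ...   | j , total≈0 = 0≉1 (≈-trans (≈-sym total≈0) (total≈1 j))
  avoids-1 (suc l) {suc m} {n} m≤l n≤k x c ε total≈1
      | inj₂ (i , j , i≢j , same) with merge i≢j
  ...   | ρ , ρ-spec = avoids-1 l (s≤s⁻¹ m≤l) n≤k x′ (ρ ∘ c) ε λ j → begin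
    ∑[ s < n ] term l (x′ (ρ (c s))) (ε s) j
      ≈⟨ ∑-cong (λ s → term-cong l (ε s) (x′∘ρ (c s)) j) ⟩
    ∑[ s < n ] term l (restrict l (x (c s))) (ε s) j
      ≡⟨ sum-cong-≗ (λ s → term-↑ˡ l (x (c s)) (ε s) j) ⟨
    ∑[ s < n ] term (suc l) (x (c s)) (ε s) (j ↑ˡ _)
      ≈⟨ total≈1 (j ↑ˡ _) ⟩
    1 ∎
    where
    open SetoidReasoning setoid

    x′ : Fin m → Vector ℕ (dim l)
    x′ a = restrict l (x (punchIn i a))

    x′∘ρ : ∀ a → x′ (ρ a) ≋ restrict l (x a)
    x′∘ρ a with ρ-spec a
    ... | inj₁ p          rewrite p = λ _ → ≈-refl
    ... | inj₂ (refl , p) rewrite p = ≈-sym ∘ colour-injective l same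

  -- The Cayley graph and its walks.

  G : AbelianGroup 0ℓ 0ℓ
  G = V (dim k)

  open AbelianGroup G using (Carrier; _∙_; _⁻¹; ε; group)
    renaming (refl to ≋-refl; sym to ≋-sym; trans to ≋-trans)

  B : Subset (AbelianGroup.setoid G)
  B = record
    { member      = λ y → ∃[ x ] ∃[ e ] (y ≋ term k x e)
    ; member-resp = λ y≋y′ (x , e , y≋) → x , e , ≋-trans (≋-sym y≋y′) y≋
    ; member?     = λ y → finite⇒∃? (finite (dim k))
        (λ x≋x′ (e , y≋) → e , ≋-trans y≋ (term-cong k e x≋x′))
        (λ x → any? (λ e → finite⇒dec (finite (dim k)) y (term k x e)))
    }

  Γ : Digraph
  Γ = Cay group B

  term-step : ∀ x g e → Digraph.Edge Γ x (x ∙ term k g e)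
  term-step x g e = term k g e , (g , e , ≋-refl) , ≋-refl

  -- Every x is the difference (f x + x) - f x of two elements of `B`.
  generates : Generates group B
  generates x = equal
    (λ j → ≈-trans (≡⇒≈ (rearrange (shift k x j) (x j) (k !))) (+-multiple (x j) (shift k x j)))
    (mul (incl (x , suc zero , ≋-refl)) (inv (incl (x , zero , ≋-refl))))
    where
    rearrange : ∀ s x K → (s + 1 * x) + K * (s + 0) ≡ x + s * suc K
    rearrange = solve-∀

  -- With g = y - x, the vertices x + (f g + g) and y + f g coincide: a forward step from x and a
  -- backward step to y meet there.
  undirected-walk : ∀ x y → Walk (underlying Γ) x y 2
  undirected-walk x y =
    step (fwd (term-step x g (suc zero)))
      (step (bwd (term k g zero , (g , zero , ≋-refl) , meet)) (stop ≋-refl))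
    where
    g : Carrier
    g = y ∙ x ⁻¹

    rearrange : ∀ x y s K → x + (s + 1 * (y + K * x)) ≡ (y + (s + 0)) + x * suc K
    rearrange = solve-∀

    meet : x ∙ term k g (suc zero) ≋ y ∙ term k g zero
    meet j = ≈-trans (≡⇒≈ (rearrange (x j) (y j) (shift k g j) (k !))) (+-multiple _ (x j))

  repeat-step : ∀ n x g e → Walk Γ x (λ j → x j + n * term k g e j) n
  repeat-step zero    x g e = stop λ j → ≡⇒≈ (sym (+-identityʳ (x j)))
  repeat-step (suc n) x g e = step (term-step x g e)
    (Walk-resp Γ ≋-refl (λ j → ≡⇒≈ (+-assoc (x j) _ _)) (repeat-step n (x ∙ term k g e) g e))

  -- y is reached by adding f g + g once and then f g another k! times, because
  -- q = k! + 1 annihilates f g.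
  directed-walk : ∀ x y → Walk Γ x y q
  directed-walk x y = step (term-step x g (suc zero))
    (Walk-resp Γ ≋-refl arrive (repeat-step (k !) (x ∙ term k g (suc zero)) g zero))
    where
    g : Carrier
    g = y ∙ x ⁻¹

    rearrange : ∀ x y s K → (x + (s + 1 * (y + K * x))) + K * (s + 0) ≡ y + (x + s) * suc K
    rearrange = solve-∀

    arrive : (λ j → (x ∙ term k g (suc zero)) j + k ! * term k g zero j) ≋ y
    arrive j = ≈-trans (≡⇒≈ (rearrange (x j) (y j) (shift k g j) (k !))) (+-multiple (y j) (x j + shift k g j))

  -- The directed distance from 0 to (1,...,1).

  walk⇒sum : ∀ {x y n} → Walk Γ x y n →
    Σ (Fin n → Carrier) λ g → Σ (Fin n → Fin 2) λ e →
    ∀ j → x j + ∑[ s < n ] term k (g s) (e s) j ≈ y j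
  walk⇒sum {x} (stop x≋y) = (λ ()) , (λ ()) , λ j → ≈-trans (≡⇒≈ (+-identityʳ (x j))) (x≋y j)
  walk⇒sum {x} {y} (step {y = z} {n = n} (b , (g₀ , e₀ , b≋) , z≋) w) with walk⇒sum w
  ... | g , e , z+∑≈y = g₀ ∷ g , e₀ ∷ e , λ j → begin
    x j + (term k g₀ e₀ j + ∑[ s < n ] term k (g s) (e s) j)  ≡⟨ +-assoc (x j) _ _ ⟨
    (x j + term k g₀ e₀ j) + ∑[ s < n ] term k (g s) (e s) j  ≈⟨ +-cong (x+b≈z j) ≈-refl ⟩
    z j + ∑[ s < n ] term k (g s) (e s) j                     ≈⟨ z+∑≈y j ⟩
    y j                                                       ∎
    where
    open SetoidReasoning setoid

    x+b≈z : ∀ j → x j + term k g₀ e₀ j ≈ z j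
    x+b≈z j = ≈-trans (+-cong (≈-refl {x j}) (≈-sym (b≋ j))) (≈-sym (z≋ j))

  distant : ∀ {n} → Walk Γ ε (const 1) n → k < n
  distant {n} w with n ≤? k
  ... | no  n≰k = ≰⇒> n≰k
  ... | yes n≤k with walk⇒sum w
  -- Taking `id` makes each summand its own point, so there are n ≤ k points and level `k` suffices.
  ...   | g , e , total≈1 = contradiction total≈1 (avoids-1 k n≤k n≤k g id e)

  edge? : ∀ x y → Dec (Digraph.Edge Γ x y)
  edge? = Cay-edge? group B

  -- The two diameters.

  undirected-diameter : ∃[ u ] (IsUndirectedDiameter Γ u × u ≤ 2)
  undirected-diameter = proj₁ diam , proj₂ diam , diameter-≤ (underlying Γ) (proj₂ diam) undirected-walk
    where
    diam : ∃[ u ] IsUndirectedDiameter Γ u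
    diam = diameter (underlying Γ) (finite (dim k)) (SymClosure? edge?) (λ x y → 2 , undirected-walk x y) ε

  directed-diameter : ∃[ d ] (IsDirectedDiameter Γ d × k ≤ d)
  directed-diameter = proj₁ diam , proj₂ diam , ≤-diameter Γ (proj₂ diam) (<⇒≤ ∘ distant)
    where
    diam : ∃[ d ] IsDirectedDiameter Γ d
    diam = diameter Γ (finite (dim k)) edge? (λ x y → q , directed-walk x y) ε

corollary5p2 : (k : ℕ) → 1 ≤ k →
    Σ (AbelianGroup 0ℓ 0ℓ) λ G → Finite (AbelianGroup.setoid G) ×
    Σ (Subset (AbelianGroup.setoid G)) λ B →
    Generates (AbelianGroup.group G) B ×
    (∃[ u ] (IsUndirectedDiameter (Cay (AbelianGroup.group G) B) u × u ≤ 2)) ×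
    (∃[ d ] (IsDirectedDiameter (Cay (AbelianGroup.group G) B) d × k ≤ d))
corollary5p2 k _ = G , finite (dim k) , B , generates , undirected-diameter , directed-diameter
  where open Construction k
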